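{- Let $c\ge2$, let $\Gamma=(V,E)$ be a $c$-uniform unoriented hypergraph with no isolated vertices, let $k\ge2$ and let $V_1,\dots,V_k$ be a partition of $V$. Assume there is an integer $m\ge1$ such that $|e\cap V_i|\in\{0,m\}$ for every $e\in E$ and every $i=1,\dots,k$. Then the functions $g_{ij}$ (for all distinct $i,j\in\{1,\dots,k\}$) are all eigenfunctions of the normalized Laplacian $L$ if and only if for all $i=1,\dots,k$ and all $v\in V$, \[ \bigl|\{e\in E: v\in e,\ e\cap V_i\neq\varnothing\}\bigr|=\begin{cases}\dfrac{(c/m-1)\deg v}{k-1}, & v\notin V_i,\\[2mm] \deg v, & v\in V_i.\end{cases} \] In this case the corresponding eigenvalue is $\dfrac{mk-c}{k-1}$.
   Context: A hypergraph has finite vertex set $V$ and edge set $E\subseteq\mathcal P(V)$; it is $c$-uniform if $|e|=c$ for all $e$, and unoriented means all incidences have orientation $+1$. $\deg v=|\{e\in E: v\in e\}|\ge1$, $D=\mathrm{diag}(\deg v)$, adjacency $A_{v,v}=0$ and $A_{v,w}=-|\{e\in E: v,w\in e\}|$ for $v\ne w$, normalized Laplacian $L=\mathrm{Id}-D^{ -1}A$. Given a partition $V_1,\dots,V_k$ of $V$ and distinct $i,j$, the function $g_{ij}\colon V\to\mathbb R$ is defined by $g_{ij}(w)=1$ if $w\in V_i$, $g_{ij}(w)=-1$ if $w\in V_j$, and $g_{ij}(w)=0$ otherwise. -}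

module Defs where

open import Algebra.Bundles.Raw using (RawMonoid)
import Algebra.Definitions.RawMonoid as RawMonoidOps
open import Data.Fin using (Fin)
import Data.Fin.Properties as Fin
open import Data.Fin.Subset using (Subset; ∣_∣; _∩_; _∈_; Empty; Nonempty)
open import Data.Fin.Subset.Properties using (_∈?_; nonempty?)
open import Data.Integer using (+_)
open import Data.List using (List; length; filter)
import Data.List.Membership.Propositional as List
open import Data.List.Relation.Unary.Unique.Propositional using (Unique)
open import Data.Nat as ℕ using (ℕ; suc; pred; NonTrivial)
import Data.Nat.Properties as ℕ
open import Data.Product using (∃; _×_; _,_)
open import Data.Rational as ℚ using (ℚ; 0ℚ; 1ℚ; ½; _/_)
import Data.Rational.Properties as ℚ
open import Data.Rational.Solver using (module +-*-Solver)
open import Level using (0ℓ)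
open import Relation.Binary.PropositionalEquality using (_≡_; _≢_; refl; sym; cong; subst)
open import Relation.Nullary using (¬_; yes; no; _×-dec_)

-- Real numbers: Cauchy sequences of rationals, with equality "the difference
-- tends to 0" and termwise operations.

record ℝ : Set where
  constructor mkℝ
  field
    seq    : ℕ → ℚ
    cauchy : ∀ ε → 0ℚ ℚ.< ε →
             ∃ λ N → ∀ p q → N ℕ.≤ p → N ℕ.≤ q → ℚ.∣ seq p ℚ.- seq q ∣ ℚ.< ε

open ℝ public

infix 4 _≈_

_≈_ : ℝ → ℝ → Set
x ≈ y = ∀ ε → 0ℚ ℚ.< ε → ∃ λ N → ∀ p → N ℕ.≤ p → ℚ.∣ seq x p ℚ.- seq y p ∣ ℚ.< ε

fromℚ : ℚ → ℝ
fromℚ r = mkℝ (λ _ → r) λ ε ε>0 → 0 , λ _ _ _ _ →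
  subst (ℚ._< ε) (sym (cong ℚ.∣_∣ (ℚ.+-inverseʳ r))) ε>0

0ℝ : ℝ
0ℝ = fromℚ 0ℚ

private
  half>0 : ∀ {ε} → 0ℚ ℚ.< ε → 0ℚ ℚ.< ½ ℚ.* ε
  half>0 {ε} ε>0 = ℚ.positive⁻¹ _ {{ℚ.pos*pos⇒pos ½ ε {{ℚ.positive ε>0}}}}

  halves : ∀ ε → ½ ℚ.* ε ℚ.+ ½ ℚ.* ε ≡ ε
  halves = solve 1 (λ e → con ½ :* e :+ con ½ :* e := e) refl
    where open +-*-Solver

  eventually-bounded : (x : ℝ) → ∃ λ B → ℚ.Positive B ×
                       ∃ λ N → ∀ p → N ℕ.≤ p → ℚ.∣ seq x p ∣ ℚ.≤ B
  eventually-bounded x with cauchy x 1ℚ (ℚ.positive⁻¹ 1ℚ)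
  ... | N , h = B , B>0 , N , bound
    where
    b = seq x N
    B = ℚ.∣ b ∣ ℚ.+ 1ℚ
    B>0 : ℚ.Positive B
    B>0 = ℚ.nonNeg+pos⇒pos ℚ.∣ b ∣ {{ℚ.nonNegative (ℚ.0≤∣p∣ b)}} 1ℚ
    split : ∀ a b → a ≡ b ℚ.+ (a ℚ.- b)
    split = solve 2 (λ a b → a := b :+ (a :- b)) refl
      where open +-*-Solver
    bound : ∀ p → N ℕ.≤ p → ℚ.∣ seq x p ∣ ℚ.≤ B
    bound p N≤p = begin
      ℚ.∣ seq x p ∣                        ≡⟨ cong ℚ.∣_∣ (split (seq x p) b) ⟩
      ℚ.∣ b ℚ.+ (seq x p ℚ.- b) ∣          ≤⟨ ℚ.∣p+q∣≤∣p∣+∣q∣ b (seq x p ℚ.- b) ⟩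
      ℚ.∣ b ∣ ℚ.+ ℚ.∣ seq x p ℚ.- b ∣      ≤⟨ ℚ.+-monoʳ-≤ ℚ.∣ b ∣ (ℚ.<⇒≤ (h p N N≤p ℕ.≤-refl)) ⟩
      B                                    ∎
      where open ℚ.≤-Reasoning

infixl 6 _+_
infixl 7 _*_

_+_ : ℝ → ℝ → ℝ
x + y = mkℝ (λ p → seq x p ℚ.+ seq y p) λ ε ε>0 →
  let M , hx = cauchy x (½ ℚ.* ε) (half>0 ε>0)
      N , hy = cauchy y (½ ℚ.* ε) (half>0 ε>0)
  in M ℕ.⊔ N , λ p q p≥ q≥ → begin-strict
    ℚ.∣ (seq x p ℚ.+ seq y p) ℚ.- (seq x q ℚ.+ seq y q) ∣
      ≡⟨ cong ℚ.∣_∣ (regroup (seq x p) (seq y p) (seq x q) (seq y q)) ⟩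
    ℚ.∣ (seq x p ℚ.- seq x q) ℚ.+ (seq y p ℚ.- seq y q) ∣
      ≤⟨ ℚ.∣p+q∣≤∣p∣+∣q∣ (seq x p ℚ.- seq x q) (seq y p ℚ.- seq y q) ⟩
    ℚ.∣ seq x p ℚ.- seq x q ∣ ℚ.+ ℚ.∣ seq y p ℚ.- seq y q ∣
      <⟨ ℚ.+-mono-< (hx p q (ℕ.m⊔n≤o⇒m≤o M N p≥) (ℕ.m⊔n≤o⇒m≤o M N q≥))
                    (hy p q (ℕ.m⊔n≤o⇒n≤o M N p≥) (ℕ.m⊔n≤o⇒n≤o M N q≥)) ⟩
    ½ ℚ.* ε ℚ.+ ½ ℚ.* ε
      ≡⟨ halves ε ⟩
    ε ∎
  where
  open ℚ.≤-Reasoning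
  regroup : ∀ a b c d → (a ℚ.+ b) ℚ.- (c ℚ.+ d) ≡ (a ℚ.- c) ℚ.+ (b ℚ.- d)
  regroup = solve 4 (λ a b c d → (a :+ b) :- (c :+ d) := (a :- c) :+ (b :- d)) refl
    where open +-*-Solver

private
  -- B * (δ / B) = δ, used to scale a tolerance δ by a bound B.
  module Scale (B : ℚ) (B>0 : ℚ.Positive B) where
    instance
      _ = B>0
      _ = ℚ.pos⇒nonZero B
      _ = ℚ.1/pos⇒pos B
      _ = ℚ.pos⇒nonNeg B

    scale : ℚ → ℚ
    scale δ = ℚ.1/ B ℚ.* δ

    scale>0 : ∀ {δ} → 0ℚ ℚ.< δ → 0ℚ ℚ.< scale δ
    scale>0 {δ} δ>0 = ℚ.positive⁻¹ _ {{ℚ.pos*pos⇒pos (ℚ.1/ B) δ {{ℚ.positive δ>0}}}}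

    product-small : ∀ {δ} s t → ℚ.∣ s ∣ ℚ.≤ B → ℚ.∣ t ∣ ℚ.< scale δ → ℚ.∣ s ℚ.* t ∣ ℚ.< δ
    product-small {δ} s t s≤B t< = begin-strict
      ℚ.∣ s ℚ.* t ∣            ≡⟨ ℚ.∣p*q∣≡∣p∣*∣q∣ s t ⟩
      ℚ.∣ s ∣ ℚ.* ℚ.∣ t ∣      ≤⟨ ℚ.*-monoʳ-≤-nonNeg ℚ.∣ t ∣ {{ℚ.nonNegative (ℚ.0≤∣p∣ t)}} s≤B ⟩
      B ℚ.* ℚ.∣ t ∣            <⟨ ℚ.*-monoʳ-<-pos B t< ⟩
      B ℚ.* (ℚ.1/ B ℚ.* δ)     ≡⟨ sym (ℚ.*-assoc B (ℚ.1/ B) δ) ⟩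
      (B ℚ.* ℚ.1/ B) ℚ.* δ     ≡⟨ cong (ℚ._* δ) (ℚ.*-inverseʳ B) ⟩
      1ℚ ℚ.* δ                 ≡⟨ ℚ.*-identityˡ δ ⟩
      δ                        ∎
      where open ℚ.≤-Reasoning

_*_ : ℝ → ℝ → ℝ
x * y = mkℝ (λ p → seq x p ℚ.* seq y p) λ ε ε>0 →
  let Bx , Bx>0 , K , bx = eventually-bounded x
      By , By>0 , L , by = eventually-bounded y
      module X = Scale Bx Bx>0
      module Y = Scale By By>0
      M , hx = cauchy x (Y.scale (½ ℚ.* ε)) (Y.scale>0 (half>0 ε>0))
      N , hy = cauchy y (X.scale (½ ℚ.* ε)) (X.scale>0 (half>0 ε>0))
  in (K ℕ.⊔ L) ℕ.⊔ (M ℕ.⊔ N) , λ p q p≥ q≥ →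
  let p≥K = ℕ.m⊔n≤o⇒m≤o K L (ℕ.m⊔n≤o⇒m≤o (K ℕ.⊔ L) (M ℕ.⊔ N) p≥)
      q≥L = ℕ.m⊔n≤o⇒n≤o K L (ℕ.m⊔n≤o⇒m≤o (K ℕ.⊔ L) (M ℕ.⊔ N) q≥)
      p≥MN = ℕ.m⊔n≤o⇒n≤o (K ℕ.⊔ L) (M ℕ.⊔ N) p≥
      q≥MN = ℕ.m⊔n≤o⇒n≤o (K ℕ.⊔ L) (M ℕ.⊔ N) q≥
      dx = seq x p ℚ.- seq x q
      dy = seq y p ℚ.- seq y q
  in begin-strict
    ℚ.∣ seq x p ℚ.* seq y p ℚ.- seq x q ℚ.* seq y q ∣
      ≡⟨ cong ℚ.∣_∣ (regroup (seq x p) (seq y p) (seq x q) (seq y q)) ⟩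
    ℚ.∣ seq x p ℚ.* dy ℚ.+ seq y q ℚ.* dx ∣
      ≤⟨ ℚ.∣p+q∣≤∣p∣+∣q∣ (seq x p ℚ.* dy) (seq y q ℚ.* dx) ⟩
    ℚ.∣ seq x p ℚ.* dy ∣ ℚ.+ ℚ.∣ seq y q ℚ.* dx ∣
      <⟨ ℚ.+-mono-<
           (X.product-small (seq x p) dy (bx p p≥K)
             (hy p q (ℕ.m⊔n≤o⇒n≤o M N p≥MN) (ℕ.m⊔n≤o⇒n≤o M N q≥MN)))
           (Y.product-small (seq y q) dx (by q q≥L)
             (hx p q (ℕ.m⊔n≤o⇒m≤o M N p≥MN) (ℕ.m⊔n≤o⇒m≤o M N q≥MN))) ⟩
    ½ ℚ.* ε ℚ.+ ½ ℚ.* ε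
      ≡⟨ halves ε ⟩
    ε ∎
  where
  open ℚ.≤-Reasoning
  regroup : ∀ a b c d → a ℚ.* b ℚ.- c ℚ.* d ≡ a ℚ.* (b ℚ.- d) ℚ.+ d ℚ.* (a ℚ.- c)
  regroup = solve 4 (λ a b c d → a :* b :- c :* d := a :* (b :- d) :+ d :* (a :- c)) refl
    where open +-*-Solver

ℝ-+-0-rawMonoid : RawMonoid 0ℓ 0ℓ
ℝ-+-0-rawMonoid = record { Carrier = ℝ ; _≈_ = _≈_ ; _∙_ = _+_ ; ε = 0ℝ }

open RawMonoidOps ℝ-+-0-rawMonoid public using () renaming (sum to sumℝ)
open RawMonoidOps ℚ.+-0-rawMonoid public using () renaming (sum to sumℚ)

-- All matrices that occur have rational entries; they act on real-valued functions.

Matrix : ℕ → Set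
Matrix n = Fin n → Fin n → ℚ

infixl 6 _-ᴹ_
infixl 7 _*ᴹ_

diagonal : ∀ {n} → (Fin n → ℚ) → Matrix n
diagonal d v w with v Fin.≟ w
... | yes _ = d v
... | no  _ = 0ℚ

identity : ∀ {n} → Matrix n
identity = diagonal (λ _ → 1ℚ)

_-ᴹ_ : ∀ {n} → Matrix n → Matrix n → Matrix n
(M -ᴹ N) v w = M v w ℚ.- N v w

_*ᴹ_ : ∀ {n} → Matrix n → Matrix n → Matrix n
(M *ᴹ N) v w = sumℚ λ u → M v u ℚ.* N u w

_·_ : ∀ {n} → Matrix n → (Fin n → ℝ) → (Fin n → ℝ)
(M · f) v = sumℝ λ w → fromℚ (M v w) * f w

IsEigenpair : ∀ {n} → Matrix n → ℝ → (Fin n → ℝ) → Set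
IsEigenpair M μ f = ¬ (∀ v → f v ≈ 0ℝ) × (∀ v → (M · f) v ≈ μ * f v)

IsEigenfunction : ∀ {n} → Matrix n → (Fin n → ℝ) → Set
IsEigenfunction M f = ∃ λ μ → IsEigenpair M μ f

fromℕ : ℕ → ℚ
fromℕ a = + a / 1

-- The vertex set is Fin n. The edge set E ⊆ P(V) is a duplicate-free list of subsets,
-- so cardinalities of sets of edges are lengths of filtered lists.

record Hypergraph (n : ℕ) : Set where
  field
    edges  : List (Subset n)
    unique : Unique edges

open Hypergraph public

_∈ᴱ_ : ∀ {n} → Subset n → Hypergraph n → Set
e ∈ᴱ Γ = e List.∈ edges Γ

Uniform : ∀ {n} → ℕ → Hypergraph n → Set
Uniform c Γ = ∀ e → e ∈ᴱ Γ → ∣ e ∣ ≡ c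

deg : ∀ {n} → Hypergraph n → Fin n → ℕ
deg Γ v = length (filter (v ∈?_) (edges Γ))

codeg : ∀ {n} → Hypergraph n → Fin n → Fin n → ℕ
codeg Γ v w = length (filter (λ e → (v ∈? e) ×-dec (w ∈? e)) (edges Γ))

NoIsolatedVertices : ∀ {n} → Hypergraph n → Set
NoIsolatedVertices Γ = ∀ v → ℕ.NonZero (deg Γ v)

adjacency : ∀ {n} → Hypergraph n → Matrix n
adjacency Γ v w with v Fin.≟ w
... | yes _ = 0ℚ
... | no  _ = ℚ.- fromℕ (codeg Γ v w)

inverseDegreeMatrix : ∀ {n} (Γ : Hypergraph n) → NoIsolatedVertices Γ → Matrix n
inverseDegreeMatrix Γ deg≥1 = diagonal λ v → (+ 1 / deg Γ v) {{deg≥1 v}}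

normalizedLaplacian : ∀ {n} (Γ : Hypergraph n) → NoIsolatedVertices Γ → Matrix n
normalizedLaplacian Γ deg≥1 = identity -ᴹ inverseDegreeMatrix Γ deg≥1 *ᴹ adjacency Γ

record Partition (k n : ℕ) : Set where
  field
    part     : Fin k → Subset n
    nonempty : ∀ i → Nonempty (part i)
    disjoint : ∀ i j → i ≢ j → Empty (part i ∩ part j)
    covers   : ∀ v → ∃ λ i → v ∈ part i

open Partition public

g : ∀ {k n} → Partition k n → Fin k → Fin k → Fin n → ℝ
g P i j w with w ∈? part P i | w ∈? part P j
... | yes _ | _     = fromℚ 1ℚ
... | no  _ | yes _ = fromℚ (ℚ.- 1ℚ)
... | no  _ | no  _ = fromℚ 0ℚ

edgesMeeting : ∀ {n} → Hypergraph n → Fin n → Subset n → ℕ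
edgesMeeting Γ v S = length (filter (λ e → (v ∈? e) ×-dec nonempty? (e ∩ S)) (edges Γ))

instance
  pred-nonZero : ∀ {k} → .{{NonTrivial k}} → ℕ.NonZero (pred k)
  pred-nonZero {suc (suc _)} = _

{-# OPTIONS --safe #-}

-- Since codeg v v = deg v, the normalized Laplacian has entries codeg v w / deg v. Counting
-- pairs (e , w) with v ∈ e and w ∈ e ∩ S gives Σ_{w ∈ Vᵢ} codeg v w = m Nᵢ(v), where Nᵢ(v) is the
-- number of edges that contain v and meet Vᵢ; hence (L gᵢⱼ)(v) = m (Nᵢ(v) − Nⱼ(v)) / deg v.
-- Off Vᵢ ∪ Vⱼ the eigenvalue equation therefore says Nᵢ(v) = Nⱼ(v). For v ∈ Vₗ we have
-- Nₗ(v) = deg v, and m Σᵢ Nᵢ(v) = c deg v by uniformity, so the remaining k − 1 values are equal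
-- exactly when they are all (c/m − 1) deg v / (k − 1).
module Submission where

open import Defs using (Hypergraph; Uniform; NoIsolatedVertices; Partition; part; _∈ᴱ_; IsEigenfunction; IsEigenpair; normalizedLaplacian; g; edgesMeeting; deg; fromℕ; fromℚ; pred-nonZero)
open import Data.Fin using (Fin)
open import Data.Fin.Subset using (Subset; ∣_∣; _∩_; _∈_; _∉_)
open import Data.Integer using (+_) renaming (_-_ to _-ℤ_)
open import Data.Nat using (ℕ; NonZero; NonTrivial; pred) renaming (_*_ to _*ℕ_)
open import Data.Product using (_×_)
open import Data.Rational using (1ℚ; _/_; _-_; _*_)
open import Data.Sum using (_⊎_)
open import Function.Bundles using (_⇔_)
open import Relation.Binary.PropositionalEquality using (_≡_; _≢_)

import Algebra.Properties.Group as GroupProperties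
import Algebra.Properties.Semiring.Sum as SemiringSum
open import Algebra.Bundles using (CommutativeRing)
open import Data.Bool using (if_then_else_; true; false)
open import Data.Fin using (zero; suc; punchIn)
open import Data.Fin.Properties using (_≟_; punchInᵢ≢i)
open import Data.Fin.Subset using (⊤)
open import Data.Fin.Subset.Properties using (_∈?_; nonempty?; ∩-identityʳ; x∈p∩q⁺; x∈p∩q⁻; ∈⊤; Empty-unique; ∣⊥∣≡0; x∈p⇒∣p-x∣<∣p∣)
open import Data.Integer using (ℤ; 1ℤ) renaming (_+_ to _+ℤ_; _*_ to _*ℤ_; -_ to -ℤ_)
import Data.Integer.Properties as ℤ
open import Data.List using (List; []; _∷_; length; filter)
import Data.List.Membership.Propositional as List
open import Data.List.Properties using (filter-≐)
open import Data.List.Relation.Unary.Any using (here; there)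
open import Data.Nat using (zero; suc) renaming (_+_ to _+ℕ_)
import Data.Nat.Properties as ℕ
import Data.Nat.Tactic.RingSolver as ℕ-Solver
open import Data.Product using (_,_; proj₁; proj₂)
open import Data.Rational using (ℚ; 0ℚ; _+_; -_; toℚᵘ)
import Data.Rational as ℚ
import Data.Rational.Properties as ℚ
open import Data.Rational.Solver using (module +-*-Solver)
open import Data.Rational.Unnormalised using (mkℚᵘ; *≡*)
import Data.Rational.Unnormalised as ℚᵘ
import Data.Rational.Unnormalised.Properties as ℚᵘ
open import Data.Sum using (inj₁; inj₂)
open import Defs using (seq; _·_; sumℝ; sumℚ; _≈_; ℝ; 0ℝ; diagonal; identity; adjacency; codeg; edges; disjoint; covers; nonempty) renaming (_*_ to _*ℝ_)
open import Data.Vec using ([]; _∷_)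
open import Function.Base using (_∘_)
open import Function.Bundles using (mk⇔)
open import Relation.Binary.PropositionalEquality using (refl; sym; trans; cong; cong₂; subst; module ≡-Reasoning)
open import Relation.Nullary.Decidable using (decidable-stable)
open import Relation.Nullary using (¬_; Dec; yes; no; does; _×-dec_; contradiction)

-- `sumℚ` unfolds to the same fold as `Σℚ.sum`, so the semiring laws collected in `Σℚ` apply to it
-- directly.
module Σℕ = SemiringSum ℕ.+-*-semiring
module Σℚ = SemiringSum (CommutativeRing.semiring ℚ.+-*-commutativeRing)

open Σℕ using (sum)
open GroupProperties ℚ.+-0-group using (x∙y⁻¹≈ε⇒x≈y)
open +-*-Solver using (solve; con; _:=_; _:+_; _:*_; _:-_; :-_)

-- Finite sums

sum-const : ∀ n a → sum {n} (λ _ → a) ≡ n *ℕ a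
sum-const zero    a = refl
sum-const (suc n) a = cong (a +ℕ_) (sum-const n a)

-- Needed twice: with `a = 0` for the brackets of the parts at one vertex, and with the common count
-- for all parts that miss the vertex.
sum-constant-except : ∀ {n} (f : Fin (suc n) → ℕ) l a → (∀ j → j ≢ l → f j ≡ a) →
                      sum f ≡ f l +ℕ n *ℕ a
sum-constant-except {n} f l a rest = begin
  sum f                             ≡⟨ Σℕ.sum-remove {i = l} f ⟩
  f l +ℕ sum (f ∘ punchIn l)        ≡⟨ cong (f l +ℕ_) (Σℕ.sum-cong-≗ λ j → rest (punchIn l j) (punchInᵢ≢i l j)) ⟩
  f l +ℕ sum {n} (λ _ → a)          ≡⟨ cong (f l +ℕ_) (sum-const n a) ⟩
  f l +ℕ n *ℕ a                     ∎
  where open ≡-Reasoning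

sumℚ-zero-except : ∀ {n} (f : Fin n → ℚ) l → (∀ j → j ≢ l → f j ≡ 0ℚ) → sumℚ f ≡ f l
sumℚ-zero-except {suc n} f l rest = begin
  sumℚ f                            ≡⟨ Σℚ.sum-remove {i = l} f ⟩
  f l + sumℚ (f ∘ punchIn l)        ≡⟨ cong (_+_ (f l)) (Σℚ.sum-cong-≗ λ j → rest (punchIn l j) (punchInᵢ≢i l j)) ⟩
  f l + sumℚ {n} (λ _ → 0ℚ)         ≡⟨ cong (_+_ (f l)) (Σℚ.sum-replicate-zero n) ⟩
  f l + 0ℚ                          ≡⟨ ℚ.+-identityʳ (f l) ⟩
  f l                               ∎
  where open ≡-Reasoning

sumℚ-distrib-- : ∀ {n} (f h : Fin n → ℚ) → sumℚ (λ w → f w - h w) ≡ sumℚ f - sumℚ h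
sumℚ-distrib-- {zero}  f h = refl
sumℚ-distrib-- {suc n} f h = trans (cong (_+_ (f zero - h zero)) (sumℚ-distrib-- (f ∘ suc) (h ∘ suc)))
  (regroup (f zero) (h zero) (sumℚ (f ∘ suc)) (sumℚ (h ∘ suc)))
  where
  regroup : ∀ a b x y → (a - b) + (x - y) ≡ (a + x) - (b + y)
  regroup = solve 4 (λ a b x y → (a :- b) :+ (x :- y) := (a :+ x) :- (b :+ y)) refl

-- Operations on `ℝ` are termwise, so every real equation below can be settled in `ℚ` at each index
-- `p`.
seq-sumℝ : ∀ {n} (f : Fin n → ℝ) p → seq (sumℝ f) p ≡ sumℚ (λ w → seq (f w) p)
seq-sumℝ {zero}  f p = refl
seq-sumℝ {suc n} f p = cong (_+_ (seq (f zero) p)) (seq-sumℝ (f ∘ suc) p)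

-- Counting

⟦_⟧ : ∀ {A : Set} → Dec A → ℕ
⟦ a? ⟧ = if does a? then 1 else 0

⟦⟧-true : ∀ {A : Set} (a? : Dec A) → A → ⟦ a? ⟧ ≡ 1
⟦⟧-true (yes _) _ = refl
⟦⟧-true (no ¬a) a = contradiction a ¬a

⟦⟧-false : ∀ {A : Set} (a? : Dec A) → ¬ A → ⟦ a? ⟧ ≡ 0
⟦⟧-false (yes a) ¬a = contradiction a ¬a
⟦⟧-false (no _)  _  = refl

⟦⟧-× : ∀ {A B : Set} (a? : Dec A) (b? : Dec B) → ⟦ a? ×-dec b? ⟧ ≡ ⟦ a? ⟧ *ℕ ⟦ b? ⟧
⟦⟧-× (yes _) (yes _) = refl
⟦⟧-× (yes _) (no _)  = refl
⟦⟧-× (no _)  _       = refl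

⟦⟧-∩ : ∀ {n} (S T : Subset n) w → ⟦ w ∈? S ∩ T ⟧ ≡ ⟦ w ∈? S ⟧ *ℕ ⟦ w ∈? T ⟧
⟦⟧-∩ S T w with w ∈? S | w ∈? T
... | yes s | yes t = ⟦⟧-true (w ∈? S ∩ T) (x∈p∩q⁺ (s , t))
... | yes _ | no ¬t = ⟦⟧-false (w ∈? S ∩ T) (¬t ∘ proj₂ ∘ x∈p∩q⁻ S T)
... | no ¬s | _     = ⟦⟧-false (w ∈? S ∩ T) (¬s ∘ proj₁ ∘ x∈p∩q⁻ S T)

length-filter-∷ : ∀ {A : Set} {P : A → Set} (P? : ∀ x → Dec (P x)) x xs →
                  length (filter P? (x ∷ xs)) ≡ ⟦ P? x ⟧ +ℕ length (filter P? xs)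
length-filter-∷ P? x xs with does (P? x)
... | true  = refl
... | false = refl

-- Brackets look only at `does`, and `does (suc w ∈? s ∷ p)` reduces to `does (w ∈? p)`; the tail of
-- the sum is thus the sum for `p` by computation.
∣p∣≡sum : ∀ {n} (p : Subset n) → ∣ p ∣ ≡ sum (λ w → ⟦ w ∈? p ⟧)
∣p∣≡sum []          = refl
∣p∣≡sum (true  ∷ p) = cong suc (∣p∣≡sum p)
∣p∣≡sum (false ∷ p) = ∣p∣≡sum p

∣p∩q∣≡sum : ∀ {n} (p q : Subset n) → ∣ p ∩ q ∣ ≡ sum (λ w → ⟦ w ∈? p ⟧ *ℕ ⟦ w ∈? q ⟧)
∣p∩q∣≡sum p q = trans (∣p∣≡sum (p ∩ q)) (Σℕ.sum-cong-≗ (⟦⟧-∩ p q))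

∣p∣≡0⊎m⇒∣p∣≡⟦nonempty⟧*m : ∀ {n} (p : Subset n) {m} → ∣ p ∣ ≡ 0 ⊎ ∣ p ∣ ≡ m →
                            ∣ p ∣ ≡ ⟦ nonempty? p ⟧ *ℕ m
∣p∣≡0⊎m⇒∣p∣≡⟦nonempty⟧*m {n} p {m} h with nonempty? p
... | no empty = trans (cong ∣_∣ (Empty-unique empty)) (∣⊥∣≡0 n)
... | yes (x , x∈p) with h
...   | inj₂ ∣p∣≡m = trans ∣p∣≡m (sym (ℕ.*-identityˡ m))
-- Removing `x` strictly shrinks `p`, so a nonempty `p` cannot have size 0.
...   | inj₁ ∣p∣≡0 = contradiction (ℕ.<-≤-trans (x∈p⇒∣p-x∣<∣p∣ x∈p) (ℕ.≤-reflexive ∣p∣≡0)) λ ()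

-- `codegIn` and `meetingIn` are `codeg` and `edgesMeeting` over a bare list, which permits
-- induction on the edges.
codegIn : ∀ {n} → List (Subset n) → Fin n → Fin n → ℕ
codegIn es v w = length (filter (λ e → (v ∈? e) ×-dec (w ∈? e)) es)

meetingIn : ∀ {n} → List (Subset n) → Fin n → Subset n → ℕ
meetingIn es v S = length (filter (λ e → (v ∈? e) ×-dec nonempty? (e ∩ S)) es)

-- Double counting, one edge at a time: `e` contributes `⟦ v ∈? e ⟧` times `∣ e ∩ S ∣` to the left
-- side, and the two-value hypothesis turns that cardinality into `m` times the bracket for `e`
-- meeting `S`.
sum-codegIn : ∀ {n} (es : List (Subset n)) v S {m} →
              (∀ e → e List.∈ es → ∣ e ∩ S ∣ ≡ 0 ⊎ ∣ e ∩ S ∣ ≡ m) →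
              sum (λ w → codegIn es v w *ℕ ⟦ w ∈? S ⟧) ≡ meetingIn es v S *ℕ m
sum-codegIn {n} [] v S _ = Σℕ.sum-replicate-zero n
sum-codegIn (e ∷ es) v S {m} h = begin
  sum (λ w → codegIn (e ∷ es) v w *ℕ ⟦ w ∈? S ⟧)
    ≡⟨ Σℕ.sum-cong-≗ split ⟩
  sum (λ w → ⟦ v ∈? e ⟧ *ℕ (⟦ w ∈? e ⟧ *ℕ ⟦ w ∈? S ⟧) +ℕ codegIn es v w *ℕ ⟦ w ∈? S ⟧)
    ≡⟨ Σℕ.∑-distrib-+ (λ w → ⟦ v ∈? e ⟧ *ℕ (⟦ w ∈? e ⟧ *ℕ ⟦ w ∈? S ⟧)) _ ⟩
  sum (λ w → ⟦ v ∈? e ⟧ *ℕ (⟦ w ∈? e ⟧ *ℕ ⟦ w ∈? S ⟧)) +ℕ sum (λ w → codegIn es v w *ℕ ⟦ w ∈? S ⟧)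
    ≡⟨ cong₂ _+ℕ_ (sym (Σℕ.*-distribˡ-sum ⟦ v ∈? e ⟧ (λ w → ⟦ w ∈? e ⟧ *ℕ ⟦ w ∈? S ⟧)))
                  (sum-codegIn es v S (λ e′ → h e′ ∘ there)) ⟩
  ⟦ v ∈? e ⟧ *ℕ sum (λ w → ⟦ w ∈? e ⟧ *ℕ ⟦ w ∈? S ⟧) +ℕ meetingIn es v S *ℕ m
    ≡⟨ cong (λ x → ⟦ v ∈? e ⟧ *ℕ x +ℕ meetingIn es v S *ℕ m)
            (trans (sym (∣p∩q∣≡sum e S)) (∣p∣≡0⊎m⇒∣p∣≡⟦nonempty⟧*m (e ∩ S) (h e (here refl)))) ⟩
  ⟦ v ∈? e ⟧ *ℕ (⟦ nonempty? (e ∩ S) ⟧ *ℕ m) +ℕ meetingIn es v S *ℕ m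
    ≡⟨ factor ⟦ v ∈? e ⟧ ⟦ nonempty? (e ∩ S) ⟧ m (meetingIn es v S) ⟩
  (⟦ v ∈? e ⟧ *ℕ ⟦ nonempty? (e ∩ S) ⟧ +ℕ meetingIn es v S) *ℕ m
    ≡⟨ cong (λ x → (x +ℕ meetingIn es v S) *ℕ m) (sym (⟦⟧-× (v ∈? e) (nonempty? (e ∩ S)))) ⟩
  (⟦ (v ∈? e) ×-dec nonempty? (e ∩ S) ⟧ +ℕ meetingIn es v S) *ℕ m
    ≡⟨ cong (_*ℕ m) (sym (length-filter-∷ (λ e → (v ∈? e) ×-dec nonempty? (e ∩ S)) e es)) ⟩
  meetingIn (e ∷ es) v S *ℕ m
    ∎
  where
  open ≡-Reasoning
  factor : ∀ a b x y → a *ℕ (b *ℕ x) +ℕ y *ℕ x ≡ (a *ℕ b +ℕ y) *ℕ x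
  factor = ℕ-Solver.solve-∀
  split : ∀ w → codegIn (e ∷ es) v w *ℕ ⟦ w ∈? S ⟧ ≡
                ⟦ v ∈? e ⟧ *ℕ (⟦ w ∈? e ⟧ *ℕ ⟦ w ∈? S ⟧) +ℕ codegIn es v w *ℕ ⟦ w ∈? S ⟧
  split w = begin
    codegIn (e ∷ es) v w *ℕ ⟦ w ∈? S ⟧
      ≡⟨ cong (_*ℕ ⟦ w ∈? S ⟧) (length-filter-∷ (λ e → (v ∈? e) ×-dec (w ∈? e)) e es) ⟩
    (⟦ (v ∈? e) ×-dec (w ∈? e) ⟧ +ℕ codegIn es v w) *ℕ ⟦ w ∈? S ⟧
      ≡⟨ cong (λ x → (x +ℕ codegIn es v w) *ℕ ⟦ w ∈? S ⟧) (⟦⟧-× (v ∈? e) (w ∈? e)) ⟩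
    (⟦ v ∈? e ⟧ *ℕ ⟦ w ∈? e ⟧ +ℕ codegIn es v w) *ℕ ⟦ w ∈? S ⟧
      ≡⟨ sym (factor ⟦ v ∈? e ⟧ ⟦ w ∈? e ⟧ ⟦ w ∈? S ⟧ (codegIn es v w)) ⟩
    ⟦ v ∈? e ⟧ *ℕ (⟦ w ∈? e ⟧ *ℕ ⟦ w ∈? S ⟧) +ℕ codegIn es v w *ℕ ⟦ w ∈? S ⟧ ∎

module _ {n} (Γ : Hypergraph n) where

  sum-codeg : ∀ v S {m} → (∀ e → e ∈ᴱ Γ → ∣ e ∩ S ∣ ≡ 0 ⊎ ∣ e ∩ S ∣ ≡ m) →
              sum (λ w → codeg Γ v w *ℕ ⟦ w ∈? S ⟧) ≡ edgesMeeting Γ v S *ℕ m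
  sum-codeg = sum-codegIn (edges Γ)

  codeg-diagonal : ∀ v → codeg Γ v v ≡ deg Γ v
  codeg-diagonal v = cong length
    (filter-≐ (λ e → (v ∈? e) ×-dec (v ∈? e)) (v ∈?_) (proj₁ , λ v∈e → v∈e , v∈e) (edges Γ))

  -- The vertex `v` itself lies in the intersection. This is the case of a vertex inside the part,
  -- and with `S = ⊤` it recovers the degree.
  edgesMeeting-∋ : ∀ {v S} → v ∈ S → edgesMeeting Γ v S ≡ deg Γ v
  edgesMeeting-∋ {v} {S} v∈S = cong length
    (filter-≐ (λ e → (v ∈? e) ×-dec nonempty? (e ∩ S)) (v ∈?_)
      (proj₁ , λ v∈e → v∈e , v , x∈p∩q⁺ (v∈e , v∈S)) (edges Γ))

-- Counting along a partition

part-unique : ∀ {k n} (P : Partition k n) {i j v} → v ∈ part P i → v ∈ part P j → i ≡ j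
part-unique P {i} {j} {v} v∈i v∈j with i ≟ j
... | yes i≡j = i≡j
... | no  i≢j = contradiction (v , x∈p∩q⁺ (v∈i , v∈j)) (disjoint P i j i≢j)

sum-parts : ∀ {k n} (P : Partition k n) v → sum (λ i → ⟦ v ∈? part P i ⟧) ≡ 1
sum-parts {zero} P v with () ← proj₁ (covers P v)
sum-parts {suc k} P v with covers P v
... | l , v∈l = begin
  sum (λ i → ⟦ v ∈? part P i ⟧)
    ≡⟨ sum-constant-except _ l 0 (λ j j≢l → ⟦⟧-false (v ∈? part P j) λ v∈j → j≢l (part-unique P v∈j v∈l)) ⟩
  ⟦ v ∈? part P l ⟧ +ℕ k *ℕ 0
    ≡⟨ cong₂ _+ℕ_ (⟦⟧-true (v ∈? part P l) v∈l) (ℕ.*-zeroʳ k) ⟩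
  1 ∎
  where open ≡-Reasoning

-- Both sides evaluate the sum of `codeg Γ v w` over all `w`: once part by part, once over the whole
-- vertex set.
sum-edgesMeeting : ∀ {c n} (Γ : Hypergraph n) → Uniform c Γ → ∀ {k} (P : Partition k n) {m} →
  (∀ e → e ∈ᴱ Γ → ∀ i → ∣ e ∩ part P i ∣ ≡ 0 ⊎ ∣ e ∩ part P i ∣ ≡ m) →
  ∀ v → sum (λ i → edgesMeeting Γ v (part P i)) *ℕ m ≡ deg Γ v *ℕ c
sum-edgesMeeting {c} Γ uniform P {m} h v = begin
  sum (λ i → edgesMeeting Γ v (part P i)) *ℕ m
    ≡⟨ Σℕ.*-distribʳ-sum m (λ i → edgesMeeting Γ v (part P i)) ⟩
  sum (λ i → edgesMeeting Γ v (part P i) *ℕ m)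
    ≡⟨ Σℕ.sum-cong-≗ (λ i → sym (sum-codeg Γ v (part P i) λ e e∈Γ → h e e∈Γ i)) ⟩
  sum (λ i → sum λ w → codeg Γ v w *ℕ ⟦ w ∈? part P i ⟧)
    ≡⟨ Σℕ.∑-comm (λ i w → codeg Γ v w *ℕ ⟦ w ∈? part P i ⟧) ⟩
  sum (λ w → sum λ i → codeg Γ v w *ℕ ⟦ w ∈? part P i ⟧)
    ≡⟨ Σℕ.sum-cong-≗ (λ w → sym (Σℕ.*-distribˡ-sum (codeg Γ v w) λ i → ⟦ w ∈? part P i ⟧)) ⟩
  sum (λ w → codeg Γ v w *ℕ sum λ i → ⟦ w ∈? part P i ⟧)
    -- The factor 1 is written as the bracket of `⊤`, so that `sum-codeg` applies again with
    -- `S = ⊤`; there uniformity puts `c` in the place of `m`.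
    ≡⟨ Σℕ.sum-cong-≗ (λ w → cong (codeg Γ v w *ℕ_) (trans (sum-parts P w) (sym (⟦⟧-true (w ∈? ⊤) ∈⊤)))) ⟩
  sum (λ w → codeg Γ v w *ℕ ⟦ w ∈? ⊤ ⟧)
    ≡⟨ sum-codeg Γ v ⊤ (λ e e∈Γ → inj₂ (trans (cong ∣_∣ (∩-identityʳ e)) (uniform e e∈Γ))) ⟩
  edgesMeeting Γ v ⊤ *ℕ c
    ≡⟨ cong (_*ℕ c) (edgesMeeting-∋ Γ ∈⊤) ⟩
  deg Γ v *ℕ c ∎
  where open ≡-Reasoning

-- Fractions

-- `_/_` divides out the gcd and is stuck on variables. Unnormalised rationals compare by
-- cross-multiplication; the second argument of `mkℚᵘ` is the denominator minus one, hence the 0.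
toℚᵘ-/1 : ∀ z → toℚᵘ (z / 1) ℚᵘ.≃ mkℚᵘ z 0
toℚᵘ-/1 z = ℚ.toℚᵘ-fromℚᵘ (mkℚᵘ z 0)

+-/1 : ∀ x y → (x +ℤ y) / 1 ≡ x / 1 + y / 1
+-/1 x y = ℚ.toℚᵘ-injective (begin
  toℚᵘ ((x +ℤ y) / 1)              ≈⟨ toℚᵘ-/1 (x +ℤ y) ⟩
  mkℚᵘ (x +ℤ y) 0                  ≈⟨ *≡* (cong (_*ℤ 1ℤ) (sym (cong₂ _+ℤ_ (ℤ.*-identityʳ x) (ℤ.*-identityʳ y)))) ⟩
  mkℚᵘ x 0 ℚᵘ.+ mkℚᵘ y 0           ≈⟨ ℚᵘ.+-cong (toℚᵘ-/1 x) (toℚᵘ-/1 y) ⟨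
  toℚᵘ (x / 1) ℚᵘ.+ toℚᵘ (y / 1)   ≈⟨ ℚ.toℚᵘ-homo-+ (x / 1) (y / 1) ⟨
  toℚᵘ (x / 1 + y / 1)             ∎)
  where open ℚᵘ.≃-Reasoning

/-*-cancel : ∀ z d .{{_ : NonZero d}} → z / d * fromℕ d ≡ z / 1
/-*-cancel z d@(suc d-1) = ℚ.toℚᵘ-injective (begin
  toℚᵘ (z / d * fromℕ d)             ≈⟨ ℚ.toℚᵘ-homo-* (z / d) (fromℕ d) ⟩
  toℚᵘ (z / d) ℚᵘ.* toℚᵘ (fromℕ d)   ≈⟨ ℚᵘ.*-cong (ℚ.toℚᵘ-fromℚᵘ (mkℚᵘ z d-1)) (toℚᵘ-/1 (+ d)) ⟩
  mkℚᵘ z d-1 ℚᵘ.* mkℚᵘ (+ d) 0       ≈⟨ *≡* (trans (ℤ.*-identityʳ _) (cong (z *ℤ_) (cong +_ (sym (ℕ.*-identityʳ d))))) ⟩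
  mkℚᵘ z 0                           ≈⟨ toℚᵘ-/1 z ⟨
  toℚᵘ (z / 1)                       ∎)
  where open ℚᵘ.≃-Reasoning

fromℕ-injective : ∀ {a b} → fromℕ a ≡ fromℕ b → a ≡ b
fromℕ-injective {a} {b} eq with *≡* p ← ℚ./-injective-≃ (mkℚᵘ (+ a) 0) (mkℚᵘ (+ b) 0) eq =
  ℤ.+-injective (trans (sym (ℤ.*-identityʳ (+ a))) (trans p (ℤ.*-identityʳ (+ b))))

fromℕ-+ : ∀ a b → fromℕ (a +ℕ b) ≡ fromℕ a + fromℕ b
fromℕ-+ a b = +-/1 (+ a) (+ b)

fromℕ-* : ∀ a b → fromℕ (a *ℕ b) ≡ fromℕ a * fromℕ b
fromℕ-* zero    b = sym (ℚ.*-zeroˡ (fromℕ b))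
fromℕ-* (suc a) b = begin
  fromℕ (b +ℕ a *ℕ b)               ≡⟨ fromℕ-+ b (a *ℕ b) ⟩
  fromℕ b + fromℕ (a *ℕ b)          ≡⟨ cong (_+_ (fromℕ b)) (fromℕ-* a b) ⟩
  fromℕ b + fromℕ a * fromℕ b       ≡⟨ factor (fromℕ a) (fromℕ b) ⟩
  (1ℚ + fromℕ a) * fromℕ b          ≡⟨ cong (_* fromℕ b) (sym (fromℕ-+ 1 a)) ⟩
  fromℕ (suc a) * fromℕ b           ∎
  where
  open ≡-Reasoning
  factor : ∀ x y → y + x * y ≡ (1ℚ + x) * y
  factor = solve 2 (λ x y → y :+ x :* y := (con 1ℚ :+ x) :* y) refl

fromℕ-sum : ∀ {n} (f : Fin n → ℕ) → fromℕ (sum f) ≡ sumℚ (fromℕ ∘ f)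
fromℕ-sum {zero}  f = refl
fromℕ-sum {suc n} f = trans (fromℕ-+ (f zero) (sum (f ∘ suc))) (cong (_+_ (fromℕ (f zero))) (fromℕ-sum (f ∘ suc)))

-/1 : ∀ a b → (+ a -ℤ + b) / 1 ≡ fromℕ a - fromℕ b
-/1 a b = begin
  (+ a -ℤ + b) / 1                             ≡⟨ add-sub ((+ a -ℤ + b) / 1) (fromℕ b) ⟩
  ((+ a -ℤ + b) / 1 + fromℕ b) - fromℕ b       ≡⟨ cong (_- fromℕ b) (sym (+-/1 (+ a -ℤ + b) (+ b))) ⟩
  (+ a -ℤ + b +ℤ + b) / 1 - fromℕ b            ≡⟨ cong (λ z → z / 1 - fromℕ b) (ℤ-cancel (+ a) (+ b)) ⟩
  fromℕ a - fromℕ b                            ∎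
  where
  open ≡-Reasoning
  add-sub : ∀ x y → x ≡ (x + y) - y
  add-sub = solve 2 (λ x y → x := (x :+ y) :- y) refl
  ℤ-cancel : ∀ x y → x -ℤ y +ℤ y ≡ x
  ℤ-cancel x y = trans (ℤ.+-assoc x (-ℤ y) y) (trans (cong (x +ℤ_) (ℤ.+-inverseˡ y)) (ℤ.+-identityʳ x))

-- Together with `/-*-cancel` this clears denominators, after which an equation between fractions is
-- a task for the ring solver.
*-fromℕ-cancelʳ : ∀ d .{{_ : NonZero d}} {x y} → x * fromℕ d ≡ y * fromℕ d → x ≡ y
*-fromℕ-cancelʳ d {x} {y} eq = trans (expand x) (trans (cong (_* (1ℤ / d)) eq) (sym (expand y)))
  where
  open ≡-Reasoning
  expand : ∀ x → x ≡ x * fromℕ d * (1ℤ / d)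
  expand x = sym (begin
    x * fromℕ d * (1ℤ / d)     ≡⟨ ℚ.*-assoc x (fromℕ d) (1ℤ / d) ⟩
    x * (fromℕ d * (1ℤ / d))   ≡⟨ cong (x *_) (trans (ℚ.*-comm (fromℕ d) (1ℤ / d)) (/-*-cancel 1ℤ d)) ⟩
    x * 1ℚ                     ≡⟨ ℚ.*-identityʳ x ⟩
    x                          ∎)

-- Here `k` is the number of parts that miss the vertex, one less than the number of all parts. The
-- hypothesis is the total count when these parts share the value `N`; it gives `N k m = d c - d m`,
-- and division by `k m` remains.
equal-share : ∀ c m .{{_ : NonZero m}} k .{{_ : NonZero k}} d N → (d +ℕ k *ℕ N) *ℕ m ≡ d *ℕ c →
              fromℕ N ≡ (+ c / m - 1ℚ) * (+ d / k)
equal-share c m k d N eq = *-fromℕ-cancelʳ k (*-fromℕ-cancelʳ m (begin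
  ιN * ιk * ιm                          ≡⟨ isolate ιd ιk ιN ιm ⟩
  (ιd + ιk * ιN) * ιm - ιd * ιm         ≡⟨ cong (_- ιd * ιm) cast ⟩
  ιd * ιc - ιd * ιm                     ≡⟨ cong₂ (λ x y → y * x - y * ιm) (sym (/-*-cancel (+ c) m)) (sym (/-*-cancel (+ d) k)) ⟩
  B * ιk * (A * ιm) - B * ιk * ιm       ≡⟨ factor A B ιk ιm ⟩
  (A - 1ℚ) * B * ιk * ιm                ∎))
  where
  open ≡-Reasoning
  A  = + c / m
  B  = + d / k
  ιc = fromℕ c
  ιd = fromℕ d
  ιk = fromℕ k
  ιm = fromℕ m
  ιN = fromℕ N
  isolate : ∀ d k N m → N * k * m ≡ (d + k * N) * m - d * m
  isolate = solve 4 (λ d k N m → N :* k :* m := (d :+ k :* N) :* m :- d :* m) refl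
  factor : ∀ A B k m → B * k * (A * m) - B * k * m ≡ (A - 1ℚ) * B * k * m
  factor = solve 4 (λ A B k m → B :* k :* (A :* m) :- B :* k :* m := (A :- con 1ℚ) :* B :* k :* m) refl
  cast : (ιd + ιk * ιN) * ιm ≡ ιd * ιc
  cast = begin
    (ιd + ιk * ιN) * ιm             ≡⟨ cong (λ x → (ιd + x) * ιm) (sym (fromℕ-* k N)) ⟩
    (ιd + fromℕ (k *ℕ N)) * ιm      ≡⟨ cong (_* ιm) (sym (fromℕ-+ d (k *ℕ N))) ⟩
    fromℕ (d +ℕ k *ℕ N) * ιm        ≡⟨ sym (fromℕ-* (d +ℕ k *ℕ N) m) ⟩
    fromℕ ((d +ℕ k *ℕ N) *ℕ m)      ≡⟨ cong fromℕ eq ⟩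
    fromℕ (d *ℕ c)                  ≡⟨ fromℕ-* d c ⟩
    ιd * ιc                         ∎

-- The left side is the value at a vertex of `part P i`, of degree `d`, of the Laplacian applied to
-- `g P i j` under the count condition. The degree cancels, so the value is the same at all such
-- vertices. There are `suc k` parts.
eigenvalue-formula : ∀ c m .{{_ : NonZero m}} k .{{_ : NonZero k}} d .{{_ : NonZero d}} →
  + 1 / d * (fromℕ m * (fromℕ d - (+ c / m - 1ℚ) * (+ d / k))) ≡ (+ (m *ℕ suc k) -ℤ + c) / k
eigenvalue-formula c m k d = *-fromℕ-cancelʳ d (*-fromℕ-cancelʳ k (begin
  q * (ιm * (ιd - (A - 1ℚ) * B)) * ιd * ιk       ≡⟨ expand q A B ιm ιd ιk ⟩
  q * ιd * (ιm * (ιd * ιk) - (A * ιm - ιm) * (B * ιk))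
    ≡⟨ cong (λ x → x * (ιm * (ιd * ιk) - (A * ιm - ιm) * (B * ιk))) (/-*-cancel (+ 1) d) ⟩
  1ℚ * (ιm * (ιd * ιk) - (A * ιm - ιm) * (B * ιk))
    ≡⟨ cong₂ (λ x y → 1ℚ * (ιm * (ιd * ιk) - (x - ιm) * y)) (/-*-cancel (+ c) m) (/-*-cancel (+ d) k) ⟩
  1ℚ * (ιm * (ιd * ιk) - (ιc - ιm) * ιd)         ≡⟨ collect ιc ιm ιd ιk ⟩
  (ιm * (1ℚ + ιk) - ιc) * ιd                     ≡⟨ cong (_* ιd) (sym numerator) ⟩
  μ * ιk * ιd                                    ≡⟨ swap μ ιk ιd ⟩
  μ * ιd * ιk                                    ∎))
  where
  open ≡-Reasoning
  μ  = (+ (m *ℕ suc k) -ℤ + c) / k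
  q  = + 1 / d
  A  = + c / m
  B  = + d / k
  ιc = fromℕ c
  ιd = fromℕ d
  ιk = fromℕ k
  ιm = fromℕ m
  expand : ∀ q A B m d k → q * (m * (d - (A - 1ℚ) * B)) * d * k ≡
                           q * d * (m * (d * k) - (A * m - m) * (B * k))
  expand = solve 6 (λ q A B m d k → q :* (m :* (d :- (A :- con 1ℚ) :* B)) :* d :* k :=
                                    q :* d :* (m :* (d :* k) :- (A :* m :- m) :* (B :* k))) refl
  collect : ∀ c m d k → 1ℚ * (m * (d * k) - (c - m) * d) ≡ (m * (1ℚ + k) - c) * d
  collect = solve 4 (λ c m d k → con 1ℚ :* (m :* (d :* k) :- (c :- m) :* d) :=
                                 (m :* (con 1ℚ :+ k) :- c) :* d) refl
  swap : ∀ x y z → x * y * z ≡ x * z * y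
  swap = solve 3 (λ x y z → x :* y :* z := x :* z :* y) refl
  numerator : μ * ιk ≡ ιm * (1ℚ + ιk) - ιc
  numerator = begin
    μ * ιk                           ≡⟨ /-*-cancel (+ (m *ℕ suc k) -ℤ + c) k ⟩
    (+ (m *ℕ suc k) -ℤ + c) / 1      ≡⟨ -/1 (m *ℕ suc k) c ⟩
    fromℕ (m *ℕ suc k) - ιc          ≡⟨ cong (_- ιc) (fromℕ-* m (suc k)) ⟩
    ιm * fromℕ (suc k) - ιc          ≡⟨ cong (λ x → ιm * x - ιc) (fromℕ-+ 1 k) ⟩
    ιm * (1ℚ + ιk) - ιc              ∎

-- Real numbers given by constant sequences

-- If `a` and `b` differed, the tolerance `∣ a - b ∣` would give `∣ a - b ∣ < ∣ a - b ∣`. Decidable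
-- equality on `ℚ` allows the argument by contradiction.
constant-≈⇒≡ : ∀ {x y a b} → (∀ p → seq x p ≡ a) → (∀ p → seq y p ≡ b) → x ≈ y → a ≡ b
constant-≈⇒≡ {x} {y} {a} {b} x≡a y≡b x≈y = decidable-stable (a ℚ.≟ b) λ a≢b →
  let N , close = x≈y ℚ.∣ a - b ∣ (∣a-b∣>0 a≢b)
  in ℚ.<-irrefl (cong₂ (λ s t → ℚ.∣ s - t ∣) (x≡a N) (y≡b N)) (close N ℕ.≤-refl)
  where
  ∣a-b∣>0 : a ≢ b → 0ℚ ℚ.< ℚ.∣ a - b ∣
  ∣a-b∣>0 a≢b = ℚ.≰⇒> λ ≤0 →
    a≢b (x∙y⁻¹≈ε⇒x≈y a b (ℚ.∣p∣≡0⇒p≡0 (a - b) (ℚ.≤-antisym ≤0 (ℚ.0≤∣p∣ (a - b)))))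

≡⇒≈ : ∀ {x y} → (∀ p → seq x p ≡ seq y p) → x ≈ y
≡⇒≈ {x} {y} x≡y ε ε>0 = 0 , λ p _ → subst (ℚ._< ε) (cong ℚ.∣_∣ (sym (x-y≡0 p))) ε>0
  where
  x-y≡0 : ∀ p → seq x p - seq y p ≡ 0ℚ
  x-y≡0 p = trans (cong (_- seq y p) (x≡y p)) (ℚ.+-inverseʳ (seq y p))

-- The functions gᵢⱼ

module _ {k n} (P : Partition k n) where

  -- A difference of brackets splits sums against `g` into one sum per part. Since `i ≢ j`, no
  -- vertex lies in both parts, the one case where the two expressions would disagree.
  seq-g : ∀ {i j} → i ≢ j → ∀ w p →
          seq (g P i j w) p ≡ fromℕ ⟦ w ∈? part P i ⟧ - fromℕ ⟦ w ∈? part P j ⟧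
  seq-g {i} {j} i≢j w p with w ∈? part P i | w ∈? part P j
  ... | yes w∈i | yes w∈j = contradiction (part-unique P w∈i w∈j) i≢j
  ... | yes _   | no _    = refl
  ... | no _    | yes _   = refl
  ... | no _    | no _    = refl

  g≢0 : ∀ {i j} → i ≢ j → ¬ (∀ v → g P i j v ≈ 0ℝ)
  g≢0 {i} {j} i≢j g≈0 =
    contradiction (constant-≈⇒≡ {g P i j v} {0ℝ} g≡1 (λ _ → refl) (g≈0 v)) λ ()
    where
    v   = proj₁ (nonempty P i)
    v∈i = proj₂ (nonempty P i)
    g≡1 : ∀ p → seq (g P i j v) p ≡ 1ℚ
    g≡1 p = trans (seq-g i≢j v p) (cong₂ (λ a b → fromℕ a - fromℕ b)
      (⟦⟧-true (v ∈? part P i) v∈i)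
      (⟦⟧-false (v ∈? part P j) λ v∈j → i≢j (part-unique P v∈i v∈j)))

-- The normalized Laplacian

diagonal-≡ : ∀ {n} (d : Fin n → ℚ) v → diagonal d v v ≡ d v
diagonal-≡ d v with v ≟ v
... | yes _  = refl
... | no v≢v = contradiction refl v≢v

diagonal-≢ : ∀ {n} (d : Fin n → ℚ) {v w} → v ≢ w → diagonal d v w ≡ 0ℚ
diagonal-≢ d {v} {w} v≢w with v ≟ w
... | yes v≡w = contradiction v≡w v≢w
... | no _    = refl

sumℚ-diagonal : ∀ {n} (d f : Fin n → ℚ) v → sumℚ (λ u → diagonal d v u * f u) ≡ d v * f v
sumℚ-diagonal d f v = trans
  (sumℚ-zero-except (λ u → diagonal d v u * f u) v λ u u≢v →
    trans (cong (_* f u) (diagonal-≢ d (u≢v ∘ sym))) (ℚ.*-zeroˡ (f u)))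
  (cong (_* f v) (diagonal-≡ d v))

adjacency-≡ : ∀ {n} (Γ : Hypergraph n) v → adjacency Γ v v ≡ 0ℚ
adjacency-≡ Γ v with v ≟ v
... | yes _  = refl
... | no v≢v = contradiction refl v≢v

adjacency-≢ : ∀ {n} (Γ : Hypergraph n) {v w} → v ≢ w → adjacency Γ v w ≡ - fromℕ (codeg Γ v w)
adjacency-≢ Γ {v} {w} v≢w with v ≟ w
... | yes v≡w = contradiction v≡w v≢w
... | no _    = refl

module _ {n} (Γ : Hypergraph n) (deg≥1 : NoIsolatedVertices Γ) where

  1/deg : Fin n → ℚ
  1/deg v = (+ 1 / deg Γ v) {{deg≥1 v}}

  -- Off the diagonal the sign in `adjacency` cancels the subtraction from the identity. On it, the
  -- entry 1 is `deg Γ v` over itself, and `deg Γ v` is `codeg Γ v v`, so one formula covers both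
  -- cases.
  normalizedLaplacian-entry : ∀ v w → normalizedLaplacian Γ deg≥1 v w ≡ 1/deg v * fromℕ (codeg Γ v w)
  normalizedLaplacian-entry v w =
    trans (cong (λ x → identity v w - x) (sumℚ-diagonal 1/deg (λ u → adjacency Γ u w) v)) (entry (v ≟ w))
    where
    off-diagonal : ∀ q x → 0ℚ - q * (- x) ≡ q * x
    off-diagonal = solve 2 (λ q x → con 0ℚ :- q :* (:- x) := q :* x) refl
    entry : Dec (v ≡ w) → identity v w - 1/deg v * adjacency Γ v w ≡ 1/deg v * fromℕ (codeg Γ v w)
    entry (no v≢w) = trans
      (cong₂ (λ x y → x - 1/deg v * y) (diagonal-≢ (λ _ → 1ℚ) v≢w) (adjacency-≢ Γ v≢w))
      (off-diagonal (1/deg v) (fromℕ (codeg Γ v w)))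
    entry (yes refl) = begin
      identity v v - 1/deg v * adjacency Γ v v
        ≡⟨ cong₂ (λ x y → x - 1/deg v * y) (diagonal-≡ (λ _ → 1ℚ) v) (adjacency-≡ Γ v) ⟩
      1ℚ - 1/deg v * 0ℚ               ≡⟨ cong (λ x → 1ℚ - x) (ℚ.*-zeroʳ (1/deg v)) ⟩
      1ℚ                              ≡⟨ sym (/-*-cancel (+ 1) (deg Γ v) {{deg≥1 v}}) ⟩
      1/deg v * fromℕ (deg Γ v)       ≡⟨ cong (λ x → 1/deg v * fromℕ x) (sym (codeg-diagonal Γ v)) ⟩
      1/deg v * fromℕ (codeg Γ v v)   ∎
      where open ≡-Reasoning

  -- The Laplacian applied to the functions gᵢⱼ

  module _ {k} (P : Partition k n) {m}
    (h : ∀ e → e ∈ᴱ Γ → ∀ i → ∣ e ∩ part P i ∣ ≡ 0 ⊎ ∣ e ∩ part P i ∣ ≡ m) where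

    private
      N : Fin k → Fin n → ℕ
      N i v = edgesMeeting Γ v (part P i)

    -- Row `v` is `codeg Γ v` scaled by `1/deg v`, and its mass on each part is known from
    -- `sum-codeg`. The result does not depend on `p`, as `constant-≈⇒≡` requires.
    seq-L·g : ∀ {i j} → i ≢ j → ∀ v p →
              seq ((normalizedLaplacian Γ deg≥1 · g P i j) v) p ≡
              1/deg v * (fromℕ m * (fromℕ (N i v) - fromℕ (N j v)))
    seq-L·g {i} {j} i≢j v p = begin
      seq ((normalizedLaplacian Γ deg≥1 · g P i j) v) p
        ≡⟨ seq-sumℝ (λ w → fromℚ (normalizedLaplacian Γ deg≥1 v w) *ℝ g P i j w) p ⟩
      sumℚ (λ w → normalizedLaplacian Γ deg≥1 v w * seq (g P i j w) p)
        ≡⟨ Σℚ.sum-cong-≗ term ⟩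
      sumℚ (λ w → 1/deg v * (mass i w - mass j w))
        ≡⟨ sym (Σℚ.*-distribˡ-sum (1/deg v) (λ w → mass i w - mass j w)) ⟩
      1/deg v * sumℚ (λ w → mass i w - mass j w)
        ≡⟨ cong (1/deg v *_) (sumℚ-distrib-- (mass i) (mass j)) ⟩
      1/deg v * (sumℚ (mass i) - sumℚ (mass j))
        ≡⟨ cong₂ (λ x y → 1/deg v * (x - y)) (total i) (total j) ⟩
      1/deg v * (fromℕ (N i v) * fromℕ m - fromℕ (N j v) * fromℕ m)
        ≡⟨ factor (1/deg v) (fromℕ m) (fromℕ (N i v)) (fromℕ (N j v)) ⟩
      1/deg v * (fromℕ m * (fromℕ (N i v) - fromℕ (N j v))) ∎
      where
      open ≡-Reasoning
      mass : Fin k → Fin n → ℚ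
      -- The product is formed in `ℕ` before the cast, so that `total` can quote the count in `ℕ`.
      mass i w = fromℕ (codeg Γ v w *ℕ ⟦ w ∈? part P i ⟧)
      distribute : ∀ q a x y → q * a * (x - y) ≡ q * (a * x - a * y)
      distribute = solve 4 (λ q a x y → q :* a :* (x :- y) := q :* (a :* x :- a :* y)) refl
      factor : ∀ q m x y → q * (x * m - y * m) ≡ q * (m * (x - y))
      factor = solve 4 (λ q m x y → q :* (x :* m :- y :* m) := q :* (m :* (x :- y))) refl
      term : ∀ w → normalizedLaplacian Γ deg≥1 v w * seq (g P i j w) p ≡ 1/deg v * (mass i w - mass j w)
      term w = begin
        normalizedLaplacian Γ deg≥1 v w * seq (g P i j w) p
          ≡⟨ cong₂ _*_ (normalizedLaplacian-entry v w) (seq-g P i≢j w p) ⟩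
        1/deg v * fromℕ (codeg Γ v w) * (fromℕ ⟦ w ∈? part P i ⟧ - fromℕ ⟦ w ∈? part P j ⟧)
          ≡⟨ distribute (1/deg v) (fromℕ (codeg Γ v w)) (fromℕ ⟦ w ∈? part P i ⟧) (fromℕ ⟦ w ∈? part P j ⟧) ⟩
        1/deg v * (fromℕ (codeg Γ v w) * fromℕ ⟦ w ∈? part P i ⟧ - fromℕ (codeg Γ v w) * fromℕ ⟦ w ∈? part P j ⟧)
          ≡⟨ cong₂ (λ x y → 1/deg v * (x - y))
               (sym (fromℕ-* (codeg Γ v w) ⟦ w ∈? part P i ⟧))
               (sym (fromℕ-* (codeg Γ v w) ⟦ w ∈? part P j ⟧)) ⟩
        1/deg v * (mass i w - mass j w) ∎
      total : ∀ i → sumℚ (mass i) ≡ fromℕ (N i v) * fromℕ m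
      total i = begin
        sumℚ (mass i)                                            ≡⟨ sym (fromℕ-sum (λ w → codeg Γ v w *ℕ ⟦ w ∈? part P i ⟧)) ⟩
        fromℕ (sum λ w → codeg Γ v w *ℕ ⟦ w ∈? part P i ⟧)       ≡⟨ cong fromℕ (sum-codeg Γ v (part P i) λ e e∈Γ → h e e∈Γ i) ⟩
        fromℕ (N i v *ℕ m)                                       ≡⟨ fromℕ-* (N i v) m ⟩
        fromℕ (N i v) * fromℕ m                                  ∎

    -- At `v` the function vanishes, so the right side of the eigenvalue equation is constantly 0
    -- whatever sequence represents `μ`. The nonzero factors `1/deg v` and `m` are then cancelled.
    eigenfunction⇒equal-counts : .{{_ : NonZero m}} → ∀ {i j} → i ≢ j →
      IsEigenfunction (normalizedLaplacian Γ deg≥1) (g P i j) →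
      ∀ {v} → v ∉ part P i → v ∉ part P j → N i v ≡ N j v
    eigenfunction⇒equal-counts {i} {j} i≢j (μ , _ , L·g≈μg) {v} v∉i v∉j =
      fromℕ-injective {N i v} {N j v} (x∙y⁻¹≈ε⇒x≈y Nᵢ Nⱼ
        (*-fromℕ-cancelʳ m {Nᵢ - Nⱼ} {0ℚ} (trans difference (sym (ℚ.*-zeroˡ (fromℕ m))))))
      where
      open ≡-Reasoning
      Nᵢ = fromℕ (N i v)
      Nⱼ = fromℕ (N j v)
      regroup : ∀ q m x d → q * (m * x) * d ≡ q * d * (x * m)
      regroup = solve 4 (λ q m x d → q :* (m :* x) :* d := q :* d :* (x :* m)) refl
      μg≡0 : ∀ p → seq μ p * seq (g P i j v) p ≡ 0ℚ
      μg≡0 p = trans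
        (cong (seq μ p *_) (trans (seq-g P i≢j v p) (cong₂ (λ a b → fromℕ a - fromℕ b)
          (⟦⟧-false (v ∈? part P i) v∉i) (⟦⟧-false (v ∈? part P j) v∉j))))
        (ℚ.*-zeroʳ (seq μ p))
      L·g≡0 : 1/deg v * (fromℕ m * (Nᵢ - Nⱼ)) ≡ 0ℚ
      L·g≡0 = constant-≈⇒≡ {(normalizedLaplacian Γ deg≥1 · g P i j) v} {μ *ℝ g P i j v}
        (seq-L·g i≢j v) μg≡0 (L·g≈μg v)
      difference : (Nᵢ - Nⱼ) * fromℕ m ≡ 0ℚ
      difference = begin
        (Nᵢ - Nⱼ) * fromℕ m
          ≡⟨ sym (ℚ.*-identityˡ _) ⟩
        1ℚ * ((Nᵢ - Nⱼ) * fromℕ m)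
          -- 1 is expanded as `1/deg v` times the degree, to expose the left side of `L·g≡0` as a
          -- factor.
          ≡⟨ cong (_* ((Nᵢ - Nⱼ) * fromℕ m)) (sym (/-*-cancel (+ 1) (deg Γ v) {{deg≥1 v}})) ⟩
        1/deg v * fromℕ (deg Γ v) * ((Nᵢ - Nⱼ) * fromℕ m)
          ≡⟨ sym (regroup (1/deg v) (fromℕ m) (Nᵢ - Nⱼ) (fromℕ (deg Γ v))) ⟩
        1/deg v * (fromℕ m * (Nᵢ - Nⱼ)) * fromℕ (deg Γ v)
          ≡⟨ cong (_* fromℕ (deg Γ v)) L·g≡0 ⟩
        0ℚ * fromℕ (deg Γ v)
          ≡⟨ ℚ.*-zeroˡ (fromℕ (deg Γ v)) ⟩
        0ℚ ∎

-- The two directions of the equivalence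

module _ (c : ℕ) {n} (Γ : Hypergraph n) (deg≥1 : NoIsolatedVertices Γ)
  {k} .{{_ : NonZero k}} (P : Partition (suc k) n) {m} .{{_ : NonZero m}}
  (h : ∀ e → e ∈ᴱ Γ → ∀ i → ∣ e ∩ part P i ∣ ≡ 0 ⊎ ∣ e ∩ part P i ∣ ≡ m) where

  private
    N : Fin (suc k) → Fin n → ℕ
    N i v = edgesMeeting Γ v (part P i)

    μ : ℚ
    μ = (+ (m *ℕ suc k) -ℤ + c) / k

  -- With `v` in part `l`, every `j ≢ l` gives a part that misses `v`, so its count equals that of
  -- `i`. Part `l` contributes the degree, and `equal-share` solves for the common value.
  eigenfunctions⇒counts : Uniform c Γ →
                          (∀ i j → i ≢ j → IsEigenfunction (normalizedLaplacian Γ deg≥1) (g P i j)) →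
                          ∀ {i v} → v ∉ part P i → fromℕ (N i v) ≡ (+ c / m - 1ℚ) * (+ deg Γ v / k)
  eigenfunctions⇒counts uniform eigen {i} {v} v∉i = equal-share c m k (deg Γ v) (N i v) (begin
    (deg Γ v +ℕ k *ℕ N i v) *ℕ m   ≡⟨ cong (λ d → (d +ℕ k *ℕ N i v) *ℕ m) (sym (edgesMeeting-∋ Γ {v} {part P l} v∈l)) ⟩
    (N l v +ℕ k *ℕ N i v) *ℕ m     ≡⟨ cong (λ x → x *ℕ m) (sym (sum-constant-except (λ j → N j v) l (N i v) λ j → counts j (j ≟ i))) ⟩
    sum (λ j → N j v) *ℕ m         ≡⟨ sum-edgesMeeting Γ uniform P h v ⟩
    deg Γ v *ℕ c                   ∎)
    where
    open ≡-Reasoning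
    l   = proj₁ (covers P v)
    v∈l = proj₂ (covers P v)
    -- The case `j ≡ i` is split off, because the comparison uses the eigenfunction for the pair
    -- `j`, `i`, which must be distinct.
    counts : ∀ j → Dec (j ≡ i) → j ≢ l → N j v ≡ N i v
    counts j (yes refl) _   = refl
    counts j (no j≢i)   j≢l = eigenfunction⇒equal-counts Γ deg≥1 P h j≢i (eigen j i j≢i) {v}
      (λ v∈j → j≢l (part-unique P v∈j v∈l)) v∉i

  -- The eigenvalue equation is checked at a vertex in part `i`, in part `j`, or in neither; there
  -- the function is 1, -1 or 0. The first two cases agree up to sign.
  counts⇒eigenpair : (∀ {i v} → v ∉ part P i → fromℕ (N i v) ≡ (+ c / m - 1ℚ) * (+ deg Γ v / k)) →
                     ∀ {i j} → i ≢ j → IsEigenpair (normalizedLaplacian Γ deg≥1) (fromℚ μ) (g P i j)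
  counts⇒eigenpair counts {i} {j} i≢j = g≢0 P i≢j , λ v →
    ≡⇒≈ {(normalizedLaplacian Γ deg≥1 · g P i j) v} {fromℚ μ *ℝ g P i j v} λ p →
    trans (seq-L·g Γ deg≥1 P h i≢j v p)
      (trans (eigen-equation v (v ∈? part P i) (v ∈? part P j)) (cong (μ *_) (sym (seq-g P i≢j v p))))
    where
    open ≡-Reasoning
    module _ (v : Fin n) where
      q = 1/deg Γ deg≥1 v
      μ-formula : q * (fromℕ m * (fromℕ (deg Γ v) - (+ c / m - 1ℚ) * (+ deg Γ v / k))) ≡ μ
      μ-formula = eigenvalue-formula c m k (deg Γ v) {{deg≥1 v}}
      negate : ∀ q m x y → q * (m * (y - x)) ≡ q * (m * (x - y)) * (0ℚ - 1ℚ)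
      negate = solve 4 (λ q m x y → q :* (m :* (y :- x)) := q :* (m :* (x :- y)) :* (con 0ℚ :- con 1ℚ)) refl
      vanish : ∀ q m x μ → q * (m * (x - x)) ≡ μ * (0ℚ - 0ℚ)
      vanish = solve 4 (λ q m x μ → q :* (m :* (x :- x)) := μ :* (con 0ℚ :- con 0ℚ)) refl
      -- The decisions are arguments, so that matching on them evaluates the brackets: the last
      -- factor becomes `1ℚ`, `0ℚ - 1ℚ` or `0ℚ - 0ℚ`.
      eigen-equation : (i? : Dec (v ∈ part P i)) (j? : Dec (v ∈ part P j)) →
        q * (fromℕ m * (fromℕ (N i v) - fromℕ (N j v))) ≡ μ * (fromℕ ⟦ i? ⟧ - fromℕ ⟦ j? ⟧)
      eigen-equation (yes v∈i) (yes v∈j) = contradiction (part-unique P v∈i v∈j) i≢j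
      eigen-equation (yes v∈i) (no v∉j) = begin
        q * (fromℕ m * (fromℕ (N i v) - fromℕ (N j v)))
          ≡⟨ cong₂ (λ x y → q * (fromℕ m * (x - y))) (cong fromℕ (edgesMeeting-∋ Γ {v} {part P i} v∈i)) (counts v∉j) ⟩
        q * (fromℕ m * (fromℕ (deg Γ v) - (+ c / m - 1ℚ) * (+ deg Γ v / k)))
          ≡⟨ μ-formula ⟩
        μ
          ≡⟨ sym (ℚ.*-identityʳ μ) ⟩
        μ * 1ℚ ∎
      eigen-equation (no v∉i) (yes v∈j) = begin
        q * (fromℕ m * (fromℕ (N i v) - fromℕ (N j v)))
          ≡⟨ cong₂ (λ x y → q * (fromℕ m * (x - y))) (counts v∉i) (cong fromℕ (edgesMeeting-∋ Γ {v} {part P j} v∈j)) ⟩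
        q * (fromℕ m * ((+ c / m - 1ℚ) * (+ deg Γ v / k) - fromℕ (deg Γ v)))
          ≡⟨ negate q (fromℕ m) (fromℕ (deg Γ v)) ((+ c / m - 1ℚ) * (+ deg Γ v / k)) ⟩
        q * (fromℕ m * (fromℕ (deg Γ v) - (+ c / m - 1ℚ) * (+ deg Γ v / k))) * (0ℚ - 1ℚ)
          ≡⟨ cong (_* (0ℚ - 1ℚ)) μ-formula ⟩
        μ * (0ℚ - 1ℚ) ∎
      eigen-equation (no v∉i) (no v∉j) = begin
        q * (fromℕ m * (fromℕ (N i v) - fromℕ (N j v)))
          ≡⟨ cong₂ (λ x y → q * (fromℕ m * (x - y))) (counts v∉i) (counts v∉j) ⟩
        q * (fromℕ m * ((+ c / m - 1ℚ) * (+ deg Γ v / k) - (+ c / m - 1ℚ) * (+ deg Γ v / k)))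
          ≡⟨ vanish q (fromℕ m) ((+ c / m - 1ℚ) * (+ deg Γ v / k)) μ ⟩
        μ * (0ℚ - 0ℚ) ∎

mainTheorem7 : ∀ (c : ℕ) .{{_ : NonTrivial c}}
    (n : ℕ) (Γ : Hypergraph n) → Uniform c Γ → (deg≥1 : NoIsolatedVertices Γ) →
    ∀ (k : ℕ) .{{_ : NonTrivial k}} (P : Partition k n)
    (m : ℕ) .{{_ : NonZero m}} →
    (∀ (e : Subset n) → e ∈ᴱ Γ → ∀ (i : Fin k) → ∣ e ∩ part P i ∣ ≡ 0 ⊎ ∣ e ∩ part P i ∣ ≡ m) →
    ((∀ (i j : Fin k) → i ≢ j → IsEigenfunction (normalizedLaplacian Γ deg≥1) (g P i j))
    ⇔
    (∀ (i : Fin k) (v : Fin n) →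
    (v ∉ part P i → fromℕ (edgesMeeting Γ v (part P i)) ≡ (+ c / m - 1ℚ) * (+ deg Γ v / pred k))
    × (v ∈ part P i → edgesMeeting Γ v (part P i) ≡ deg Γ v)))
    ×
    ((∀ (i j : Fin k) → i ≢ j → IsEigenfunction (normalizedLaplacian Γ deg≥1) (g P i j)) →
    ∀ (i j : Fin k) → i ≢ j →
    IsEigenpair (normalizedLaplacian Γ deg≥1) (fromℚ ((+ (m *ℕ k) -ℤ + c) / pred k)) (g P i j))
-- Matching on two successors makes `pred` of the number of parts reduce to the `suc k` that the
-- lemmas take as denominator.
mainTheorem7 c n Γ uniform deg≥1 (suc (suc k)) P m h =
  mk⇔
    (λ eigen i v → eigenfunctions⇒counts c Γ deg≥1 P h uniform eigen {i} {v} , edgesMeeting-∋ Γ {v} {part P i})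
    (λ counts i j i≢j → fromℚ ((+ (m *ℕ suc (suc k)) -ℤ + c) / suc k) ,
      counts⇒eigenpair c Γ deg≥1 P h (λ {i} {v} → proj₁ (counts i v)) {i} {j} i≢j) ,
  -- The eigenvalues hidden in `eigen` are not inspected: the functions yield the counts, and the
  -- counts yield the stated eigenvalue.
  λ eigen i j i≢j → counts⇒eigenpair c Γ deg≥1 P h
    (λ {i} {v} → eigenfunctions⇒counts c Γ deg≥1 P h uniform eigen {i} {v}) {i} {j} i≢j
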